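{- (1) Let $G=(V,E)$ be a multigraph with $|V|=s\geq 2$ vertices and $|E|=m\geq s(1+\varepsilon)$ edges for some $\varepsilon=\varepsilon(s)\in(0,1]$. Then there exists a set of vertices $S\subseteq V$ of size $|S|\leq 8\log(s)\cdot\lceil 1/\varepsilon\rceil$ spanning at least $|S|+1$ edges. (2) Let $t\geq 3$ be an integer, and let $G=(V,E)$ be a $t$-hypergraph with $|V|=s\geq 2$ vertices and $|E|=m$ hyperedges. Let $k\in\mathbb{N}$ satisfy $2^{t+2}\log(s)\leq k\leq s$. If \[ m\geq 3s\left(\frac{2^{t+3}\cdot s\cdot\log(s)}{k}\right)^{t-2}, \] then there exists a subset $S\subseteq V$ of size $|S|\leq k$ that spans at least $|S|+\frac{k}{2^{t+1}\log(s)}$ hyperedges.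
   Context: A multigraph is a graph that may contain parallel edges and (possibly parallel) self-loops. A $t$-hypergraph is a hypergraph in which every hyperedge contains at most $t$ distinct vertices, and parallel hyperedges are allowed. A set of vertices $S$ spans an edge (or hyperedge) $e$ if all vertices of $e$ belong to $S$. Logarithms are base $2$. -}

module Defs where

open import Data.Nat using (ℕ; zero; suc; _+_; _*_; _^_; _≤_; _<_)
open import Data.Nat.DivMod using (_/_)
open import Data.Product using (_×_)
open import Data.List using (List; length; filter)
open import Data.Fin using (Fin)
open import Data.Fin.Subset using (Subset; _∈_; _⊆_; ∣_∣)
open import Data.Fin.Subset.Properties using (_∈?_; _⊆?_)
open import Relation.Nullary using (Dec; _×-dec_)

-- Real-valued base-2 logarithm is not available; comparisons with log are
-- encoded exactly in ℕ:  for b > 0,   a / b ≤ log₂ s   ⟺   2 ^ a ≤ s ^ b.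
_/_≤log₂_ : ℕ → ℕ → ℕ → Set
a / b ≤log₂ s = 2 ^ a ≤ s ^ b

-- ⌈ q / p ⌉ for p > 0 (p = 0 gives 0, never used)
⌈_÷_⌉ : ℕ → ℕ → ℕ
⌈ q ÷ zero ⌉ = 0
⌈ q ÷ suc p ⌉ = (q + p) / suc p

-- A multigraph on vertex set Fin s: a list of edges, each an (unordered) pair
-- of endpoints; parallel edges and (parallel) self-loops allowed.
Multigraph : ℕ → Set
Multigraph s = List (Fin s × Fin s)

spansEdge : ∀ {s} (S : Subset s) (e : Fin s × Fin s) → Dec ((Data.Product.proj₁ e ∈ S) × (Data.Product.proj₂ e ∈ S))
spansEdge S (u Data.Product., v) = (u ∈? S) ×-dec (v ∈? S)

eG : ∀ {s} → Multigraph s → Subset s → ℕ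
eG E S = length (filter (spansEdge S) E)

-- A hypergraph on Fin s: a list of hyperedges (parallel allowed), each a
-- nonempty set of vertices.
Hypergraph : ℕ → Set
Hypergraph s = List (Subset s)

IsTHypergraph : ∀ {s} → ℕ → Hypergraph s → Set
IsTHypergraph t H = Data.List.Relation.Unary.All.All (λ e → 1 ≤ ∣ e ∣ × ∣ e ∣ ≤ t) H
  where import Data.List.Relation.Unary.All

eH : ∀ {s} → Hypergraph s → Subset s → ℕ
eH H S = length (filter (λ e → e ⊆? S) H)

{-# OPTIONS --safe #-}
module Submission where

-- Part (1). Put N = ⌈1/ε⌉. Grow breadth-first balls around a vertex, keeping apart the tree edges
-- and the chords (the remaining edges meeting the ball). If the edges meeting a ball B number
-- fewer than (1 + 1/N)|B|, then deleting B leaves a graph at least as dense; otherwise, while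
-- there is at most one chord, the next ball is larger by a factor 1 + 1/N. So a second chord
-- appears at some radius d with 2^d ≤ s^N, and the tree paths from the root to the ends of two
-- chords give at most 4d + 3 vertices spanning an excess edge.
--
-- Part (2). A random set T of ℓ vertices meets a proportion ℓ/s of the hyperedges; removing one
-- vertex of T from each of these lowers t by one. After t − 2 rounds there is a multigraph with at
-- least 3s edges, to which part (1) with ε = 1 applies repeatedly: as long as the set found so
-- far spans at most s edges, the unspanned ones still number 2s. The union of r = ⌊x⌋ + 1 + (t − 2)ℓ
-- such sets, where x = k / (2^(t+1) log s) and ℓ = ⌊x⌋ − 1, also pays for the deleted vertices.

open import Defs
open import Data.Nat hiding (_/_; _%_)
open import Data.Nat.DivMod using (_/_; _%_; m≡m%n+[m/n]*n; m%n<n)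
open import Data.Nat.Properties
open import Data.Nat.Tactic.RingSolver using (solve-∀)
open import Data.Fin using (Fin; zero; suc) renaming (_≟_ to _≟ᶠ_)
open import Data.Fin.Subset using (Subset; Nonempty; inside; outside; ⊥; ⊤; ⁅_⁆; _∪_; _─_; _-_; ∣_∣; _∈_; _∉_; _⊆_)
open import Data.Fin.Subset.Properties
open import Data.List using (List; []; _∷_; _++_; length; filter)
open import Data.List.Properties using (filter-++; filter-accept; filter-reject; filter-all; length-++; ++-assoc)
open import Data.List.Relation.Unary.All as All using (All; []; _∷_)
open import Data.List.Relation.Unary.All.Properties using (++⁻)
open import Data.List.Relation.Binary.Permutation.Propositional using (_↭_; refl; prep; ↭-sym; ↭-trans)
open import Data.List.Relation.Binary.Permutation.Propositional.Properties
  using (shift; filter-↭; ↭-length; All-resp-↭) renaming (++⁺ˡ to ↭-++⁺ˡ)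
open import Data.Product using (_×_; _,_; proj₁; proj₂; ∃-syntax)
open import Data.Sum using (_⊎_; inj₁; inj₂; [_,_]′)
open import Data.Vec using ([]; _∷_; here; there)
open import Level using (0ℓ)
open import Function using (_∘_)
open import Relation.Nullary using (¬_; Dec; yes; no; ¬?; contradiction)
open import Relation.Nullary.Decidable using (_⊎-dec_)
open import Relation.Unary using (Pred; Decidable)
open import Relation.Binary.PropositionalEquality

private
  variable
    n s : ℕ

-- Cardinalities of subsets and counts in filtered lists.

∣p∪q∣≤∣p∣+∣q∣ : (p q : Subset n) → ∣ p ∪ q ∣ ≤ ∣ p ∣ + ∣ q ∣
∣p∪q∣≤∣p∣+∣q∣ []            []            = z≤n
∣p∪q∣≤∣p∣+∣q∣ (outside ∷ p) (outside ∷ q) = ∣p∪q∣≤∣p∣+∣q∣ p q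
∣p∪q∣≤∣p∣+∣q∣ (outside ∷ p) (inside ∷ q)  =
  ≤-trans (s≤s (∣p∪q∣≤∣p∣+∣q∣ p q)) (≤-reflexive (sym (+-suc ∣ p ∣ ∣ q ∣)))
∣p∪q∣≤∣p∣+∣q∣ (inside ∷ p)  (outside ∷ q) = s≤s (∣p∪q∣≤∣p∣+∣q∣ p q)
∣p∪q∣≤∣p∣+∣q∣ (inside ∷ p)  (inside ∷ q)  =
  s≤s (≤-trans (∣p∪q∣≤∣p∣+∣q∣ p q) (+-monoʳ-≤ ∣ p ∣ (n≤1+n ∣ q ∣)))

∣p∪⁅x⁆∣≤1+∣p∣ : (p : Subset n) (x : Fin n) → ∣ p ∪ ⁅ x ⁆ ∣ ≤ suc ∣ p ∣
∣p∪⁅x⁆∣≤1+∣p∣ p x = begin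
  ∣ p ∪ ⁅ x ⁆ ∣       ≤⟨ ∣p∪q∣≤∣p∣+∣q∣ p ⁅ x ⁆ ⟩
  ∣ p ∣ + ∣ ⁅ x ⁆ ∣   ≡⟨ cong (∣ p ∣ +_) (∣⁅x⁆∣≡1 x) ⟩
  ∣ p ∣ + 1           ≡⟨ +-comm ∣ p ∣ 1 ⟩
  suc ∣ p ∣           ∎
  where open ≤-Reasoning

x∈p∪⁅x⁆ : (p : Subset n) (x : Fin n) → x ∈ p ∪ ⁅ x ⁆
x∈p∪⁅x⁆ p x = q⊆p∪q p ⁅ x ⁆ (x∈⁅x⁆ x)

x∉p⇒∣p∣<∣p∪⁅x⁆∣ : (p : Subset n) {x : Fin n} → x ∉ p → ∣ p ∣ < ∣ p ∪ ⁅ x ⁆ ∣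
x∉p⇒∣p∣<∣p∪⁅x⁆∣ p {x} x∉p = p⊂q⇒∣p∣<∣q∣ (p⊆p∪q ⁅ x ⁆ , x , x∈p∪⁅x⁆ p x , x∉p)

∣p─q∣+∣q∣≤∣p∣ : (p q : Subset n) → q ⊆ p → ∣ p ─ q ∣ + ∣ q ∣ ≤ ∣ p ∣
∣p─q∣+∣q∣≤∣p∣ []            []            q⊆p = z≤n
∣p─q∣+∣q∣≤∣p∣ (outside ∷ p) (outside ∷ q) q⊆p = ∣p─q∣+∣q∣≤∣p∣ p q (drop-∷-⊆ q⊆p)
∣p─q∣+∣q∣≤∣p∣ (inside ∷ p)  (outside ∷ q) q⊆p = s≤s (∣p─q∣+∣q∣≤∣p∣ p q (drop-∷-⊆ q⊆p))
∣p─q∣+∣q∣≤∣p∣ (inside ∷ p)  (inside ∷ q)  q⊆p =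
  ≤-trans (≤-reflexive (+-suc ∣ p ─ q ∣ ∣ q ∣)) (s≤s (∣p─q∣+∣q∣≤∣p∣ p q (drop-∷-⊆ q⊆p)))
∣p─q∣+∣q∣≤∣p∣ (outside ∷ p) (inside ∷ q)  q⊆p with () ← q⊆p {zero} here

module _ {A B : Set} {P : Pred A 0ℓ} {Q : Pred B 0ℓ} (P? : Decidable P) (Q? : Decidable Q) where

  count-skip : ∀ xs y ys → length (filter P? xs) ≤ length (filter Q? ys) →
               length (filter P? xs) ≤ length (filter Q? (y ∷ ys))
  count-skip xs y ys le with Q? y
  ... | yes _ = m≤n⇒m≤1+n le
  ... | no  _ = le

  count-∷ : ∀ x xs y ys → (P x → Q y) → length (filter P? xs) ≤ length (filter Q? ys) →
            length (filter P? (x ∷ xs)) ≤ length (filter Q? (y ∷ ys))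
  count-∷ x xs y ys P⇒Q le with P? x
  ... | no  _  = count-skip xs y ys le
  ... | yes Px with Q? y
  ...   | yes _  = s≤s le
  ...   | no ¬Qy = contradiction (P⇒Q Px) ¬Qy

count-complement : ∀ {A : Set} {P : Pred A 0ℓ} (P? : Decidable P) xs →
                   length (filter P? xs) + length (filter (¬? ∘ P?) xs) ≡ length xs
count-complement P? []       = refl
count-complement P? (x ∷ xs) with P? x
... | yes _ = cong suc (count-complement P? xs)
... | no  _ = trans (+-suc (length (filter P? xs)) _) (cong suc (count-complement P? xs))

count-disjoint : ∀ {A : Set} {P Q R : Pred A 0ℓ} (P? : Decidable P) (Q? : Decidable Q) (R? : Decidable R) →
                 (∀ {x} → P x → R x) → (∀ {x} → Q x → R x) → ∀ xs →
                 length (filter P? xs) + length (filter Q? (filter (¬? ∘ P?) xs)) ≤ length (filter R? xs)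
count-disjoint P? Q? R? P⇒R Q⇒R []       = z≤n
count-disjoint P? Q? R? P⇒R Q⇒R (x ∷ xs) with ih ← count-disjoint P? Q? R? P⇒R Q⇒R xs | P? x
... | yes Px with R? x
...   | yes _  = s≤s ih
...   | no ¬Rx = contradiction (P⇒R Px) ¬Rx
count-disjoint P? Q? R? P⇒R Q⇒R (x ∷ xs) | no _ with Q? x | R? x
...   | no _   | no _   = ih
...   | no _   | yes _  = m≤n⇒m≤1+n ih
...   | yes Qx | no ¬Rx = contradiction (Q⇒R Qx) ¬Rx
...   | yes _  | yes _  = ≤-trans (≤-reflexive (+-suc (length (filter P? xs)) _)) (s≤s ih)

-- Spanned edges, and enlarging a vertex set without loss of excess.

Spans : Subset s → Fin s × Fin s → Set
Spans S (u , v) = u ∈ S × v ∈ S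

eG-++ : (E F : Multigraph s) (S : Subset s) → eG (E ++ F) S ≡ eG E S + eG F S
eG-++ E F S = trans (cong length (filter-++ (spansEdge S) E F)) (length-++ (filter (spansEdge S) E))

eG-↭ : {E F : Multigraph s} → E ↭ F → ∀ S → eG E S ≡ eG F S
eG-↭ E↭F S = ↭-length (filter-↭ (spansEdge S) E↭F)

eG-accept : ∀ {e} (E : Multigraph s) {S} → Spans S e → eG (e ∷ E) S ≡ suc (eG E S)
eG-accept E {S} S∋e = cong length (filter-accept (spansEdge S) {xs = E} S∋e)

eG-reject : ∀ {e} (E : Multigraph s) {S} → ¬ Spans S e → eG (e ∷ E) S ≡ eG E S
eG-reject E {S} S∌e = cong length (filter-reject (spansEdge S) {xs = E} S∌e)

Spans-mono : ∀ {S T : Subset s} {e} → S ⊆ T → Spans S e → Spans T e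
Spans-mono S⊆T (p , q) = S⊆T p , S⊆T q

eG-∷-≥ : ∀ e (E : Multigraph s) S → eG E S ≤ eG (e ∷ E) S
eG-∷-≥ e E S = count-skip (spansEdge S) (spansEdge S) E e E ≤-refl

eG-mono : (E : Multigraph s) {S T : Subset s} → S ⊆ T → eG E S ≤ eG E T
eG-mono []      S⊆T = z≤n
eG-mono (e ∷ E) {S} {T} S⊆T =
  count-∷ (spansEdge S) (spansEdge T) e E e E (Spans-mono {e = e} S⊆T) (eG-mono E S⊆T)

-- `gain` says that the excess, edges of `F` spanned minus vertices, does not drop from `S` to `T`;
-- it is rearranged to avoid subtraction.
record Grows (F : Multigraph s) (n : ℕ) (S T : Subset s) : Set where
  field
    ⊆-ext : S ⊆ T
    size  : ∣ T ∣ ≤ n + ∣ S ∣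
    gain  : eG F S + ∣ T ∣ ≤ eG F T + ∣ S ∣

open Grows

Grows-refl : {F : Multigraph s} {S : Subset s} → Grows F 0 S S
Grows-refl = record { ⊆-ext = λ x → x ; size = ≤-refl ; gain = ≤-refl }

Grows-≤ : ∀ {F : Multigraph s} {m n S T} → m ≤ n → Grows F m S T → Grows F n S T
Grows-≤ m≤n g = record { ⊆-ext = ⊆-ext g ; size = ≤-trans (size g) (+-monoˡ-≤ _ m≤n) ; gain = gain g }

Grows-trans : ∀ {F : Multigraph s} {m n S T U} → Grows F m S T → Grows F n T U → Grows F (n + m) S U
Grows-trans {F = F} {m} {n} {S} {T} {U} g h = record
  { ⊆-ext = ⊆-ext h ∘ ⊆-ext g
  ; size  = begin
      ∣ U ∣             ≤⟨ size h ⟩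
      n + ∣ T ∣         ≤⟨ +-monoʳ-≤ n (size g) ⟩
      n + (m + ∣ S ∣)   ≡⟨ +-assoc n m ∣ S ∣ ⟨
      n + m + ∣ S ∣     ∎
  ; gain  = +-cancelʳ-≤ (eG F T + ∣ T ∣) _ _ (begin
      eG F S + ∣ U ∣ + (eG F T + ∣ T ∣)     ≡⟨ rearrange (eG F S) (∣ U ∣) (eG F T) (∣ T ∣) ⟩
      (eG F S + ∣ T ∣) + (eG F T + ∣ U ∣)   ≤⟨ +-mono-≤ (gain g) (gain h) ⟩
      (eG F T + ∣ S ∣) + (eG F U + ∣ T ∣)   ≡⟨ rearrange′ (eG F T) (∣ S ∣) (eG F U) (∣ T ∣) ⟩
      eG F U + ∣ S ∣ + (eG F T + ∣ T ∣)     ∎)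
  }
  where
  open ≤-Reasoning
  rearrange : ∀ a b c d → a + b + (c + d) ≡ (a + d) + (c + b)
  rearrange = solve-∀
  rearrange′ : ∀ a b c d → (a + b) + (c + d) ≡ c + b + (a + d)
  rearrange′ = solve-∀

-- A further edge cannot spoil the gain: if `S` spans it, so does the larger `T`.
Grows-∷ : ∀ e {F : Multigraph s} {n S T} → Grows F n S T → Grows (e ∷ F) n S T
Grows-∷ e {F} {n} {S} {T} g = record { ⊆-ext = ⊆-ext g ; size = size g ; gain = gain′ }
  where
  gain′ : eG (e ∷ F) S + ∣ T ∣ ≤ eG (e ∷ F) T + ∣ S ∣
  gain′ with spansEdge S e
  ... | yes p rewrite eG-accept F p | eG-accept F (Spans-mono {e = e} (⊆-ext g) p) = s≤s (gain g)
  ... | no ¬p rewrite eG-reject F ¬p = ≤-trans (gain g) (+-monoˡ-≤ ∣ S ∣ (eG-∷-≥ e F T))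

-- Quantifying over every `S` that contains `r`, and not only the singleton, lets one absorption
-- start from the result of another, so overlapping tree paths cause no loss of excess.
Absorbs : Multigraph s → Fin s → ℕ → (Subset s → Set) → Set
Absorbs F r n P = ∀ S → r ∈ S → ∃[ T ] (P T × Grows F n S T)

Reaches : Multigraph s → Fin s → ℕ → Fin s → Set
Reaches F r n v = Absorbs F r n (v ∈_)

Ball : Multigraph s → Fin s → ℕ → Subset s → Set
Ball F r n B = ∀ {v} → v ∈ B → Reaches F r n v

Reaches-∷ : ∀ e {F : Multigraph s} {r n v} → Reaches F r n v → Reaches (e ∷ F) r n v
Reaches-∷ e reach S r∈S with T , v∈T , g ← reach S r∈S = T , v∈T , Grows-∷ e g

Ball-suc : ∀ {F : Multigraph s} {r n B} → Ball F r n B → Ball F r (suc n) B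
Ball-suc ball v∈B S r∈S with T , v∈T , g ← ball v∈B S r∈S = T , v∈T , Grows-≤ (n≤1+n _) g

-- A set that already contains the far endpoint needs no further vertex; otherwise
-- the new vertex comes with the new edge e, which keeps the gain nonnegative.
Reaches-step : ∀ {F : Multigraph s} {r n u v} e → (∀ {S} → Spans S e → v ∈ S) →
               (∀ {S} → u ∈ S → v ∈ S → Spans S e) →
               Reaches F r n u → Reaches (e ∷ F) r (suc n) v
Reaches-step {F = F} {r} {n} {u} {v} e far join reach S r∈S
  with T , u∈T , g ← Reaches-∷ e {F} {v = u} reach S r∈S with v ∈? T
... | yes v∈T = T , v∈T , Grows-≤ (n≤1+n _) g
... | no  v∉T = T′ , x∈p∪⁅x⁆ T v , Grows-trans g step
  where
  T′ = T ∪ ⁅ v ⁆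
  T⊆T′ : T ⊆ T′
  T⊆T′ = p⊆p∪q ⁅ v ⁆
  step : Grows (e ∷ F) 1 T T′
  step = record
    { ⊆-ext = T⊆T′
    ; size  = ∣p∪⁅x⁆∣≤1+∣p∣ T v
    ; gain  = begin
        eG (e ∷ F) T + ∣ T′ ∣     ≡⟨ cong (_+ ∣ T′ ∣) (eG-reject F (v∉T ∘ far)) ⟩
        eG F T + ∣ T′ ∣           ≤⟨ +-mono-≤ (eG-mono F T⊆T′) (∣p∪⁅x⁆∣≤1+∣p∣ T v) ⟩
        eG F T′ + suc ∣ T ∣       ≡⟨ +-suc (eG F T′) ∣ T ∣ ⟩
        suc (eG F T′) + ∣ T ∣     ≡⟨ cong (_+ ∣ T ∣) (eG-accept F (join (T⊆T′ u∈T) (x∈p∪⁅x⁆ T v))) ⟨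
        eG (e ∷ F) T′ + ∣ T ∣     ∎
    }
    where open ≤-Reasoning

-- Breadth-first exploration of balls.

Meets : Subset s → Fin s × Fin s → Set
Meets B (u , v) = u ∈ B ⊎ v ∈ B

Joins : Subset s → Subset s → Fin s × Fin s → Set
Joins B C (u , v) = (u ∈ B × v ∈ C) ⊎ (v ∈ B × u ∈ C)

-- One round of breadth-first search from a ball B of radius n around r: new is the ball of
-- radius n + 1, tree a set of tree edges, chords the other edges meeting B.
record Exploration (A B C : Subset s) (r : Fin s) (n : ℕ) (F Q : Multigraph s) : Set where
  field
    new         : Subset s
    tree        : Multigraph s
    chords rest : Multigraph s
    split       : tree ++ chords ++ rest ↭ F ++ Q
    old⊆new     : C ⊆ new
    new⊆A       : new ⊆ A
    tree<new    : length tree < ∣ new ∣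
    ball        : Ball tree r n B
    new-ball    : Ball tree r (suc n) new
    join        : All (Joins B new) chords
    avoid       : All (¬_ ∘ Meets B) rest

open Exploration

-- A scan of the list `Q`, with `F` and `C` the tree edges and vertices collected so far. An edge
-- missing `B` goes to `rest`; one leading from `B` into `C` (a loop in particular) is a chord; any
-- other extends both `F` and `C` by one, which preserves `length F < ∣ C ∣`. As `B` stays fixed,
-- each new vertex is one step from the old ball.
explore : ∀ (A B C : Subset s) {r n} F Q → C ⊆ A → B ⊆ C → length F < ∣ C ∣ →
          Ball F r n B → Ball F r (suc n) C → All (Spans A) Q → Exploration A B C r n F Q
explore A B C F [] C⊆A B⊆C F<C bB bC [] = record
  { new = C ; tree = F ; chords = [] ; rest = [] ; split = refl ; old⊆new = λ x → x ; new⊆A = C⊆A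
  ; tree<new = F<C ; ball = bB ; new-ball = bC ; join = [] ; avoid = [] }
explore A B C {r} {n} F (e@(u , v) ∷ Q) C⊆A B⊆C F<C bB bC ((u∈A , v∈A) ∷ Q⊆A)
  with (u ∈? B) ⊎-dec (v ∈? B)
... | no ¬meets = record
  { Exploration ih hiding (rest; split; avoid)
  ; rest  = e ∷ rest ih
  ; split = ↭-trans to-front (↭-trans (prep e (split ih)) (↭-sym (shift e F Q)))
  ; avoid = ¬meets ∷ avoid ih
  }
  where
  ih = explore A B C F Q C⊆A B⊆C F<C bB bC Q⊆A
  to-front : tree ih ++ chords ih ++ e ∷ rest ih ↭ e ∷ tree ih ++ chords ih ++ rest ih
  to-front = ↭-trans (↭-++⁺ˡ (tree ih) (shift e (chords ih) (rest ih)))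
                     (shift e (tree ih) (chords ih ++ rest ih))
... | yes meets = [ (λ u∈B → classify u v u∈B v∈A (λ v∈new → inj₁ (u∈B , v∈new)) proj₂ _,_)
                  , (λ v∈B → classify v u v∈B u∈A (λ u∈new → inj₂ (v∈B , u∈new)) proj₁ (λ p q → q , p)) ]′ meets
  where
  -- `x` is an end of `e` in `B` and `y` the other end; the three function arguments translate this
  -- orientation back to the pair `e`, so one argument serves both orientations.
  classify : ∀ x y → x ∈ B → y ∈ A → (∀ {S} → y ∈ S → Joins B S e) → (∀ {S} → Spans S e → y ∈ S) →
             (∀ {S} → x ∈ S → y ∈ S → Spans S e) → Exploration A B C r n F (e ∷ Q)
  classify x y x∈B y∈A joins far near with y ∈? C
  ... | yes y∈C = record
    { Exploration ih hiding (chords; split; join)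
    ; chords = e ∷ chords ih
    ; split  = ↭-trans (shift e (tree ih) (chords ih ++ rest ih))
                 (↭-trans (prep e (split ih)) (↭-sym (shift e F Q)))
    ; join   = joins (old⊆new ih y∈C) ∷ join ih
    }
    where
    ih = explore A B C F Q C⊆A B⊆C F<C bB bC Q⊆A
  ... | no y∉C = record
    { Exploration ih hiding (split; old⊆new)
    ; split   = ↭-trans (split ih) (↭-sym (shift e F Q))
    ; old⊆new = old⊆new ih ∘ p⊆p∪q ⁅ y ⁆
    }
    where
    C′ = C ∪ ⁅ y ⁆
    C′⊆A : C′ ⊆ A
    C′⊆A z∈C′ with x∈p∪q⁻ C ⁅ y ⁆ z∈C′
    ... | inj₁ z∈C = C⊆A z∈C
    ... | inj₂ z∈y rewrite x∈⁅y⁆⇒x≡y y z∈y = y∈A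
    bC′ : Ball (e ∷ F) r (suc n) C′
    bC′ z∈C′ with x∈p∪q⁻ C ⁅ y ⁆ z∈C′
    ... | inj₁ z∈C = Reaches-∷ e (bC z∈C)
    ... | inj₂ z∈y rewrite x∈⁅y⁆⇒x≡y y z∈y = Reaches-step e far near (bB x∈B)
    ih = explore A B C′ (e ∷ F) Q C′⊆A (p⊆p∪q ⁅ y ⁆ ∘ B⊆C)
           (≤-<-trans F<C (x∉p⇒∣p∣<∣p∪⁅x⁆∣ C y∉C))
           (λ z∈B → Reaches-∷ e (bB z∈B)) bC′ Q⊆A

-- Exponential growth and the resulting bound on the radius.

*-swap : ∀ a b c → a * (b * c) ≡ b * (a * c)
*-swap = solve-∀

-- Bernoulli's inequality 1 + k/N ≤ (1 + 1/N)^k without denominators. At `k = N` it shows that `N`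
-- rounds of growth by 1 + 1/N at least double.
bernoulli : ∀ N k → N ^ k * (N + k) ≤ N * suc N ^ k
bernoulli N zero    = ≤-reflexive (trans (+-identityʳ (N + 0)) (trans (+-identityʳ N) (sym (*-identityʳ N))))
bernoulli N (suc k) = begin
  N * N ^ k * (N + suc k)                 ≤⟨ m≤m+n _ (k * N ^ k) ⟩
  N * N ^ k * (N + suc k) + k * N ^ k     ≡⟨ regroup N (N ^ k) k ⟩
  suc N * (N ^ k * (N + k))               ≤⟨ *-monoʳ-≤ (suc N) (bernoulli N k) ⟩
  suc N * (N * suc N ^ k)                 ≡⟨ *-swap (suc N) N (suc N ^ k) ⟩
  N * (suc N * suc N ^ k)                 ∎
  where
  open ≤-Reasoning
  regroup : ∀ N P k → N * P * (N + suc k) + k * P ≡ suc N * (P * (N + k))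
  regroup = solve-∀

2*N^N≤[1+N]^N : ∀ N .{{_ : NonZero N}} → 2 * N ^ N ≤ suc N ^ N
2*N^N≤[1+N]^N N = *-cancelˡ-≤ N (≤-trans (≤-reflexive (regroup N (N ^ N))) (bernoulli N N))
  where
  regroup : ∀ N P → N * (2 * P) ≡ P * (N + N)
  regroup = solve-∀

^-distribʳ-* : ∀ m n k → (m * n) ^ k ≡ m ^ k * n ^ k
^-distribʳ-* m n zero    = refl
^-distribʳ-* m n (suc k) = trans (cong (m * n *_) (^-distribʳ-* m n k)) (interchange m n (m ^ k) (n ^ k))
  where
  interchange : ∀ a b c d → a * b * (c * d) ≡ a * c * (b * d)
  interchange = solve-∀

-- Exponential growth by 1 + 1/N per round gives at most N log₂ s rounds.
growth⇒2^d≤s^N : ∀ {s} N .{{_ : NonZero N}} d → suc N ^ d ≤ N ^ d * s → 2 ^ d ≤ s ^ N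
growth⇒2^d≤s^N {s} N d growth = *-cancelʳ-≤ (2 ^ d) (s ^ N) (N ^ (N * d)) {{m^n≢0 N (N * d)}} (begin
  2 ^ d * N ^ (N * d)     ≡⟨ cong (2 ^ d *_) (^-*-assoc N N d) ⟨
  2 ^ d * (N ^ N) ^ d     ≡⟨ ^-distribʳ-* 2 (N ^ N) d ⟨
  (2 * N ^ N) ^ d         ≤⟨ ^-monoˡ-≤ d (2*N^N≤[1+N]^N N) ⟩
  (suc N ^ N) ^ d         ≡⟨ ^-*-assoc (suc N) N d ⟩
  suc N ^ (N * d)         ≡⟨ cong (suc N ^_) (*-comm N d) ⟩
  suc N ^ (d * N)         ≡⟨ ^-*-assoc (suc N) d N ⟨
  (suc N ^ d) ^ N         ≤⟨ ^-monoˡ-≤ N growth ⟩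
  (N ^ d * s) ^ N         ≡⟨ ^-distribʳ-* (N ^ d) s N ⟩
  (N ^ d) ^ N * s ^ N     ≡⟨ cong (_* s ^ N) (^-*-assoc N d N) ⟩
  N ^ (d * N) * s ^ N     ≡⟨ cong (λ j → N ^ j * s ^ N) (*-comm d N) ⟩
  N ^ (N * d) * s ^ N     ≡⟨ *-comm (N ^ (N * d)) (s ^ N) ⟩
  s ^ N * N ^ (N * d)     ∎)
  where open ≤-Reasoning

-- The Moore-type bound: a small set of positive excess.

-- The end in `B` costs at most `d` vertices, the end in the next ball at most `d + 1`. The gain is
-- measured on the tree `F` alone, so the chord itself remains as surplus.
absorb-chord : ∀ {F : Multigraph s} {r d B C} e → Ball F r d B → Ball F r (suc d) C → Joins B C e →
               Absorbs F r (suc d + d) (λ T → Spans T e)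
absorb-chord (u , v) bB bC (inj₁ (u∈B , v∈C)) S r∈S
  with T , u∈T , g ← bB u∈B S r∈S
  with U , v∈U , h ← bC v∈C T (⊆-ext g r∈S) = U , (⊆-ext h u∈T , v∈U) , Grows-trans g h
absorb-chord (u , v) bB bC (inj₂ (v∈B , u∈C)) S r∈S
  with T , v∈T , g ← bB v∈B S r∈S
  with U , u∈U , h ← bC u∈C T (⊆-ext g r∈S) = U , (u∈U , ⊆-ext h v∈T) , Grows-trans g h

Ball-root : (r : Fin s) → Ball [] r 0 ⁅ r ⁆
Ball-root r v∈r S r∈S rewrite x∈⁅y⁆⇒x≡y r v∈r = S , r∈S , Grows-refl

module Moore {s : ℕ} (N : ℕ) .{{_ : NonZero N}} where

  -- The size bound 3 + 4N log₂ s, expressed through an integer radius `d` at most N log₂ s.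
  Excess : Multigraph s → Set
  Excess E = ∃[ S ] ∃[ d ] (∣ S ∣ ≤ 3 + 4 * d × 2 ^ d ≤ s ^ N × suc ∣ S ∣ ≤ eG E S)

  Dense : Subset s → Multigraph s → Set
  Dense A E = suc N * ∣ A ∣ ≤ N * length E

  -- Starting from the root alone, two absorptions add at most 2(2d + 1) vertices. The tree edges
  -- spanned then number at least `∣ U ∣ - 1`, and the two chords raise this to `∣ U ∣ + 1`.
  two-chords : ∀ {F : Multigraph s} {r d B C} e f cs → Ball F r d B → Ball F r (suc d) C →
               Joins B C e → Joins B C f → 2 ^ d ≤ s ^ N → Excess (F ++ e ∷ f ∷ cs)
  two-chords {F} {r} {d} e f cs bB bC je jf 2^d≤s^N
    with T , eT , g ← absorb-chord e bB bC je ⁅ r ⁆ (x∈⁅x⁆ r)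
    with U , fU , h ← absorb-chord f bB bC jf T (⊆-ext g (x∈⁅x⁆ r))
    = U , d , bound , 2^d≤s^N , excess
    where
    open ≤-Reasoning
    gh = Grows-trans g h
    bound : ∣ U ∣ ≤ 3 + 4 * d
    bound = begin
      ∣ U ∣                                   ≤⟨ size gh ⟩
      suc d + d + (suc d + d) + ∣ ⁅ r ⁆ ∣     ≡⟨ cong (suc d + d + (suc d + d) +_) (∣⁅x⁆∣≡1 r) ⟩
      suc d + d + (suc d + d) + 1             ≡⟨ collect d ⟩
      3 + 4 * d                               ∎
      where
      collect : ∀ d → suc d + d + (suc d + d) + 1 ≡ 3 + 4 * d
      collect = solve-∀
    eU : Spans U e
    eU = Spans-mono {e = e} (⊆-ext h) eT
    excess : suc ∣ U ∣ ≤ eG (F ++ e ∷ f ∷ cs) U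
    excess = begin
      1 + ∣ U ∣                           ≤⟨ s≤s (m≤n+m ∣ U ∣ (eG F ⁅ r ⁆)) ⟩
      1 + (eG F ⁅ r ⁆ + ∣ U ∣)            ≤⟨ s≤s (gain gh) ⟩
      1 + (eG F U + ∣ ⁅ r ⁆ ∣)            ≡⟨ cong (λ j → 1 + (eG F U + j)) (∣⁅x⁆∣≡1 r) ⟩
      1 + (eG F U + 1)                    ≡⟨ +-suc (eG F U) 1 ⟨
      eG F U + 2                          ≤⟨ +-monoʳ-≤ (eG F U) (s≤s (s≤s z≤n)) ⟩
      eG F U + suc (suc (eG cs U))        ≡⟨ cong (λ j → eG F U + suc j) (eG-accept cs fU) ⟨
      eG F U + suc (eG (f ∷ cs) U)        ≡⟨ cong (eG F U +_) (eG-accept (f ∷ cs) eU) ⟨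
      eG F U + eG (e ∷ f ∷ cs) U          ≡⟨ eG-++ F (e ∷ f ∷ cs) U ⟨
      eG (F ++ e ∷ f ∷ cs) U              ∎

  Excess-mono : ∀ E E′ → (∀ S → eG E′ S ≤ eG E S) → Excess E′ → Excess E
  Excess-mono E E′ E′≤E (S , d , p , q , x) = S , d , p , q , ≤-trans x (E′≤E S)

  -- One call per radius `d`, with `growth` recording that `B` has at least (1 + 1/N)^d vertices.
  -- `B` gains a vertex in each round and has at most `s`, so the fuel cannot run out. `rec` is the
  -- induction hypothesis for fewer vertices, invoked when `B` is deleted.
  grow : ∀ fuel A E → All (Spans A) E → Dense A E →
         (∀ A′ E′ → ∣ A′ ∣ < ∣ A ∣ → All (Spans A′) E′ → 0 < length E′ → Dense A′ E′ → Excess E′) →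
         ∀ d B F Q r → F ++ Q ↭ E → r ∈ B → B ⊆ A → length F < ∣ B ∣ → Ball F r d B →
         suc N ^ d ≤ N ^ d * ∣ B ∣ → s < fuel + ∣ B ∣ → Excess E
  grow zero A E E⊆A dense rec d B F Q r F++Q r∈B B⊆A F<B ball growth fuel =
    contradiction (∣p∣≤n B) (<⇒≱ fuel)
  grow (suc fuel) A E E⊆A dense rec d B F Q r F++Q r∈B B⊆A F<B ball growth s<fuel = body
    where
    Q⊆A : All (Spans A) Q
    Q⊆A = proj₂ (++⁻ F (All-resp-↭ (↭-sym F++Q) E⊆A))
    X : Exploration A B B r d F Q
    X = explore A B B F Q B⊆A (λ x → x) F<B ball (Ball-suc ball) Q⊆A
    split-E : tree X ++ chords X ++ rest X ↭ E
    split-E = ↭-trans (split X) F++Q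
    count : ∀ S → eG (tree X ++ chords X) S + eG (rest X) S ≡ eG E S
    count S = trans (sym (eG-++ (tree X ++ chords X) (rest X) S))
                (trans (cong (λ L → eG L S) (++-assoc (tree X) (chords X) (rest X))) (eG-↭ split-E S))
    2^d≤s^N : 2 ^ d ≤ s ^ N
    2^d≤s^N = growth⇒2^d≤s^N N d (≤-trans growth (*-monoʳ-≤ (N ^ d) (∣p∣≤n B)))
    x = length (tree X) + length (chords X)
    ∣E∣ : x + length (rest X) ≡ length E
    ∣E∣ = trans (+-assoc (length (tree X)) _ _)
            (trans (cong (length (tree X) +_) (sym (length-++ (chords X))))
              (trans (sym (length-++ (tree X))) (↭-length split-E)))
    rest⊆A─B : All (Spans (A ─ B)) (rest X)
    rest⊆A─B = All.zipWith (λ { ((u∈A , v∈A) , avoids) →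
                    x∈p∧x∉q⇒x∈p─q u∈A (avoids ∘ inj₁) , x∈p∧x∉q⇒x∈p─q v∈A (avoids ∘ inj₂) })
                 (proj₂ (++⁻ (chords X) (proj₂ (++⁻ (tree X) (All-resp-↭ (↭-sym split-E) E⊆A)))) , avoid X)

    -- Only the `x` edges outside `rest` are lost with `B`, fewer than its share (1 + 1/N)∣B∣, so
    -- `A ─ B` is strictly denser than required. The strictness also shows that some edge remains.
    sparse-ball : N * x < suc N * ∣ B ∣ → Excess E
    sparse-ball sparse = Excess-mono E (rest X)
      (λ S → ≤-trans (m≤n+m _ (eG (tree X ++ chords X) S)) (≤-reflexive (count S)))
      (rec (A ─ B) (rest X) (p∩q≢∅⇒∣p─q∣<∣p∣ A B (r , x∈p∩q⁺ (B⊆A r∈B , r∈B)))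
        rest⊆A─B rest>0 (<⇒≤ denser))
      where
      open ≤-Reasoning
      denser : suc N * ∣ A ─ B ∣ < N * length (rest X)
      denser = +-cancelʳ-< (suc N * ∣ B ∣) _ _ (begin-strict
        suc N * ∣ A ─ B ∣ + suc N * ∣ B ∣     ≡⟨ *-distribˡ-+ (suc N) ∣ A ─ B ∣ ∣ B ∣ ⟨
        suc N * (∣ A ─ B ∣ + ∣ B ∣)           ≤⟨ *-monoʳ-≤ (suc N) (∣p─q∣+∣q∣≤∣p∣ A B B⊆A) ⟩
        suc N * ∣ A ∣                         ≤⟨ dense ⟩
        N * length E                          ≡⟨ cong (N *_) ∣E∣ ⟨
        N * (x + length (rest X))             ≡⟨ *-distribˡ-+ N x _ ⟩
        N * x + N * length (rest X)           ≡⟨ +-comm (N * x) _ ⟩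
        N * length (rest X) + N * x           <⟨ +-monoʳ-< (N * length (rest X)) sparse ⟩
        N * length (rest X) + suc N * ∣ B ∣   ∎)
      rest>0 : 0 < length (rest X)
      rest>0 = *-cancelˡ-< N 0 _ (≤-<-trans (≤-reflexive (*-zeroʳ N)) (≤-<-trans z≤n denser))

    few-chords : length (chords X) ≤ 1 → Excess E
    few-chords chords≤1 with N * x <? suc N * ∣ B ∣
    ... | yes sparse = sparse-ball sparse
    -- A chord found now returns to the edges to be scanned. Both its ends lie in the new ball, so
    -- it is a chord again in the next round.
    ... | no  ¬sparse = grow fuel A E E⊆A dense rec (suc d) (new X) (tree X) (chords X ++ rest X) r
            split-E (old⊆new X r∈B) (new⊆A X) (tree<new X) (new-ball X) growth′ s<fuel′
      where
      open ≤-Reasoning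
      -- With at most one chord, `x` is at most one more than the number of tree edges, hence at
      -- most the size of the new ball.
      larger : suc N * ∣ B ∣ ≤ N * ∣ new X ∣
      larger = ≤-trans (≮⇒≥ ¬sparse) (*-monoʳ-≤ N (begin
        length (tree X) + length (chords X)   ≤⟨ +-monoʳ-≤ (length (tree X)) chords≤1 ⟩
        length (tree X) + 1                   ≡⟨ +-comm (length (tree X)) 1 ⟩
        suc (length (tree X))                 ≤⟨ tree<new X ⟩
        ∣ new X ∣                             ∎))
      growth′ : suc N ^ suc d ≤ N ^ suc d * ∣ new X ∣
      growth′ = begin
        suc N * suc N ^ d           ≤⟨ *-monoʳ-≤ (suc N) growth ⟩
        suc N * (N ^ d * ∣ B ∣)     ≡⟨ *-swap (suc N) (N ^ d) (∣ B ∣) ⟩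
        N ^ d * (suc N * ∣ B ∣)     ≤⟨ *-monoʳ-≤ (N ^ d) larger ⟩
        N ^ d * (N * ∣ new X ∣)     ≡⟨ regroup (N ^ d) N (∣ new X ∣) ⟩
        N * N ^ d * ∣ new X ∣       ∎
        where
        regroup : ∀ a b c → a * (b * c) ≡ b * a * c
        regroup = solve-∀
      B<new : ∣ B ∣ < ∣ new X ∣
      B<new = *-cancelˡ-< N _ _ (begin-strict
        N * ∣ B ∣           <⟨ m<n+m (N * ∣ B ∣) (≤-trans (s≤s z≤n) F<B) ⟩
        suc N * ∣ B ∣       ≤⟨ larger ⟩
        N * ∣ new X ∣       ∎)
      s<fuel′ : s < fuel + ∣ new X ∣
      s<fuel′ = begin-strict
        s                       <⟨ s<fuel ⟩
        suc fuel + ∣ B ∣        ≡⟨ +-suc fuel ∣ B ∣ ⟨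
        fuel + suc ∣ B ∣        ≤⟨ +-monoʳ-≤ fuel B<new ⟩
        fuel + ∣ new X ∣        ∎

    body : Excess E
    body with chords X in eq | join X
    ... | []         | _ = few-chords (≤-trans (≤-reflexive (cong length eq)) z≤n)
    ... | _ ∷ []     | _ = few-chords (≤-reflexive (cong length eq))
    ... | e ∷ f ∷ cs | je ∷ jf ∷ _ = Excess-mono E (tree X ++ e ∷ f ∷ cs)
      (λ S → ≤-trans (m≤m+n _ (eG (rest X) S))
               (≤-reflexive (trans (cong (λ L → eG (tree X ++ L) S + eG (rest X) S) (sym eq)) (count S))))
      (two-chords e f cs (Exploration.ball X) (new-ball X) je jf 2^d≤s^N)

  -- Strong induction on `∣ A ∣`. Nonemptiness of `E` is carried along to supply a root: an end of
  -- the first edge, as a ball of radius 0 with no tree edges.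
  dense⇒excess : ∀ fuel A E → ∣ A ∣ < fuel → All (Spans A) E → 0 < length E → Dense A E → Excess E
  dense⇒excess zero       A E                A<fuel = contradiction z≤n (<⇒≱ A<fuel)
  dense⇒excess (suc fuel) A E@((u , v) ∷ E′) A<fuel E⊆A@((u∈A , _) ∷ _) _ dense =
    grow s A E E⊆A dense
      (λ A′ E″ A′<A → dense⇒excess fuel A′ E″ (<-≤-trans A′<A (s≤s⁻¹ A<fuel)))
      0 ⁅ u ⁆ [] E u refl (x∈⁅x⁆ u)
      (λ w∈u → subst (_∈ A) (sym (x∈⁅y⁆⇒x≡y u w∈u)) u∈A)
      (≤-reflexive (sym (∣⁅x⁆∣≡1 u))) (Ball-root u)
      (≤-reflexive (trans (sym (∣⁅x⁆∣≡1 u)) (sym (+-identityʳ _))))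
      (≤-reflexive (trans (+-comm 1 s) (cong (s +_) (sym (∣⁅x⁆∣≡1 u)))))

-- Since 1 ≤ log₂ s, the summand 3 of the size bound is at most 3 log₂ s. The exponent is 7 for
-- `N = 1`, one below the 8 of part (1); part (2) spends that difference.
moore : ∀ {s} → 2 ≤ s → ∀ N .{{_ : NonZero N}} (E : Multigraph s) → suc N * s ≤ N * length E →
        ∃[ S ] (2 ^ ∣ S ∣ ≤ s ^ (3 + 4 * N) × suc ∣ S ∣ ≤ eG E S)
moore {s} 2≤s N E dense = bound-size (Moore.dense⇒excess N (suc s) ⊤ E
  (s≤s (∣p∣≤n ⊤)) (All.universal (λ _ → ∈⊤ , ∈⊤) E) E>0
  (subst (λ j → suc N * j ≤ N * length E) (sym (∣⊤∣≡n s)) dense))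
  where
  open ≤-Reasoning
  E>0 : 0 < length E
  E>0 = *-cancelˡ-< N 0 _ (begin-strict
    N * 0           ≡⟨ *-zeroʳ N ⟩
    0               <⟨ <-≤-trans z<s 2≤s ⟩
    s               ≤⟨ m≤m+n s (N * s) ⟩
    suc N * s       ≤⟨ dense ⟩
    N * length E    ∎)
  instance
    s≢0 : NonZero s
    s≢0 = >-nonZero (<-≤-trans z<s 2≤s)
  bound-size : Moore.Excess N E → ∃[ S ] (2 ^ ∣ S ∣ ≤ s ^ (3 + 4 * N) × suc ∣ S ∣ ≤ eG E S)
  bound-size (S , d , bound , 2^d≤s^N , excess) = S , (begin
    2 ^ ∣ S ∣               ≤⟨ ^-monoʳ-≤ 2 bound ⟩
    2 ^ (3 + 4 * d)         ≡⟨ ^-distribˡ-+-* 2 3 (4 * d) ⟩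
    2 ^ 3 * 2 ^ (4 * d)     ≡⟨ cong (λ j → 2 ^ 3 * 2 ^ j) (*-comm 4 d) ⟩
    2 ^ 3 * 2 ^ (d * 4)     ≡⟨ cong (2 ^ 3 *_) (^-*-assoc 2 d 4) ⟨
    2 ^ 3 * (2 ^ d) ^ 4     ≤⟨ *-mono-≤ (^-monoˡ-≤ 3 2≤s) (^-monoˡ-≤ 4 2^d≤s^N) ⟩
    s ^ 3 * (s ^ N) ^ 4     ≡⟨ cong (s ^ 3 *_) (^-*-assoc s N 4) ⟩
    s ^ 3 * s ^ (N * 4)     ≡⟨ cong (λ j → s ^ 3 * s ^ j) (*-comm N 4) ⟩
    s ^ 3 * s ^ (4 * N)     ≡⟨ ^-distribˡ-+-* s 3 (4 * N) ⟨
    s ^ (3 + 4 * N)         ∎) , excess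

-- Part (1) for ε = p/q.

q≤⌈q÷p⌉*p : ∀ q p → 0 < p → q ≤ ⌈ q ÷ p ⌉ * p
q≤⌈q÷p⌉*p q (suc p) _ = +-cancelˡ-≤ p _ _ (begin
  p + q                                                     ≡⟨ +-comm p q ⟩
  q + p                                                     ≡⟨ m≡m%n+[m/n]*n (q + p) (suc p) ⟩
  (q + p) % suc p + (q + p) / suc p * suc p                 ≤⟨ +-monoˡ-≤ _ (s≤s⁻¹ (m%n<n (q + p) (suc p))) ⟩
  p + (q + p) / suc p * suc p                               ∎)
  where open ≤-Reasoning

-- With N = ⌈q/p⌉, the inequality q ≤ Np says 1/N ≤ ε, so the hypothesis gives at least (1 + 1/N)s
-- edges.
graph-part : ∀ s → 2 ≤ s → (E : Multigraph s) → ∀ p q → 0 < p → p ≤ q → q * length E ≥ s * (q + p) →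
             ∃[ S ] (2 ^ ∣ S ∣ ≤ s ^ (8 * ⌈ q ÷ p ⌉) × suc ∣ S ∣ ≤ eG E S)
graph-part s 2≤s E p q 0<p p≤q hyp = widen (moore 2≤s N E dense)
  where
  open ≤-Reasoning
  N = ⌈ q ÷ p ⌉
  q≤Np = q≤⌈q÷p⌉*p q p 0<p
  instance
    q≢0 : NonZero q
    q≢0 = >-nonZero (<-≤-trans 0<p p≤q)
    N≢0 : NonZero N
    N≢0 = ≢-nonZero (λ N≡0 → <⇒≱ (<-≤-trans 0<p p≤q) (subst (λ j → q ≤ j * p) N≡0 q≤Np))
    s≢0 : NonZero s
    s≢0 = >-nonZero (<-≤-trans z<s 2≤s)
  dense : suc N * s ≤ N * length E
  dense = *-cancelˡ-≤ q (begin
    q * (suc N * s)             ≡⟨ expand q N s ⟩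
    s * (N * q + q)             ≤⟨ *-monoʳ-≤ s (+-monoʳ-≤ (N * q) q≤Np) ⟩
    s * (N * q + N * p)         ≡⟨ factor s N q p ⟩
    N * (s * (q + p))           ≤⟨ *-monoʳ-≤ N hyp ⟩
    N * (q * length E)          ≡⟨ *-swap N q (length E) ⟩
    q * (N * length E)          ∎)
    where
    expand : ∀ q N s → q * (suc N * s) ≡ s * (N * q + q)
    expand = solve-∀
    factor : ∀ s N q p → s * (N * q + N * p) ≡ N * (s * (q + p))
    factor = solve-∀
  exponent : 3 + 4 * N ≤ 8 * N
  exponent = begin
    3 + 4 * N           ≤⟨ +-monoˡ-≤ (4 * N) (≤-trans (n≤1+n 3) (*-monoʳ-≤ 4 (>-nonZero⁻¹ N))) ⟩
    4 * N + 4 * N       ≡⟨ *-distribʳ-+ N 4 4 ⟨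
    8 * N               ∎
  widen : ∃[ S ] (2 ^ ∣ S ∣ ≤ s ^ (3 + 4 * N) × suc ∣ S ∣ ≤ eG E S) →
          ∃[ S ] (2 ^ ∣ S ∣ ≤ s ^ (8 * N) × suc ∣ S ∣ ≤ eG E S)
  widen (S , size , excess) = S , ≤-trans size (^-monoʳ-≤ s exponent) , excess

-- Averaging over vertex sets of a given size.

1≤∣p∣⇒Nonempty : {p : Subset n} → 1 ≤ ∣ p ∣ → Nonempty p
1≤∣p∣⇒Nonempty {n} {p} 1≤∣p∣ with nonempty? p
... | yes ne = ne
... | no ¬ne = contradiction (trans (cong ∣_∣ (Empty-unique ¬ne)) (∣⊥∣≡0 n)) (>⇒≢ 1≤∣p∣)

x∈p⇒1≤∣p∣ : {p : Subset n} {x : Fin n} → x ∈ p → 1 ≤ ∣ p ∣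
x∈p⇒1≤∣p∣ {p = p} {x} x∈p = ≤-trans (s≤s z≤n) (x∈p⇒∣p-x∣<∣p∣ x∈p)

hits : Subset n → List (Fin n) → ℕ
hits T X = length (filter (_∈? T) X)

zeros : List (Fin (suc n)) → ℕ
zeros []          = 0
zeros (zero ∷ X)  = suc (zeros X)
zeros (suc _ ∷ X) = zeros X

preds : List (Fin (suc n)) → List (Fin n)
preds []          = []
preds (zero ∷ X)  = preds X
preds (suc x ∷ X) = x ∷ preds X

length-zeros-preds : (X : List (Fin (suc n))) → length X ≡ zeros X + length (preds X)
length-zeros-preds []          = refl
length-zeros-preds (zero ∷ X)  = cong suc (length-zeros-preds X)
length-zeros-preds (suc x ∷ X) = trans (cong suc (length-zeros-preds X)) (sym (+-suc (zeros X) _))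

hits-outside : ∀ (T : Subset n) X → hits T (preds X) ≤ hits (outside ∷ T) X
hits-outside T []          = z≤n
hits-outside T (zero ∷ X)  = hits-outside T X
hits-outside T (suc x ∷ X) = count-∷ (_∈? T) (_∈? (outside ∷ T)) x (preds X) (suc x) X there (hits-outside T X)

hits-inside : ∀ (T : Subset n) X → zeros X + hits T (preds X) ≤ hits (inside ∷ T) X
hits-inside T []          = z≤n
hits-inside T (zero ∷ X)  = s≤s (hits-inside T X)
hits-inside T (suc x ∷ X) with x ∈? T
... | yes x∈T = begin
  zeros X + suc (hits T (preds X))     ≡⟨ +-suc (zeros X) _ ⟩
  suc (zeros X + hits T (preds X))     ≤⟨ s≤s (hits-inside T X) ⟩
  suc (hits (inside ∷ T) X)            ∎
  where open ≤-Reasoning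
... | no _ = hits-inside T X

-- A uniformly random T of size 1 + j in a ground set of size 1 + i + j contains the first
-- element with probability (1 + j) / (1 + i + j), so the better of the two choices does at
-- least as well as the expectation.
average : ∀ {n} i j z x {a b V} .{{_ : NonZero n}} → n ≡ i + j → x * j ≤ n * a → x * suc j ≤ n * b →
          z + a ≤ V → b ≤ V → (z + x) * suc j ≤ suc n * V
average i j z x {a} {b} {V} refl xj≤ xj+x≤ z+a≤V b≤V = *-cancelˡ-≤ (i + j) (begin
  (i + j) * ((z + x) * suc j)                                       ≡⟨ expand i j z x ⟩
  suc j * (i + j) * z + suc j * (x * j) + i * (x * suc j)           ≤⟨ bound ⟩
  suc j * (i + j) * z + suc j * ((i + j) * a) + i * ((i + j) * b)   ≡⟨ factor i j z a b ⟩
  (i + j) * (suc j * (z + a) + i * b)                               ≤⟨ bound′ ⟩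
  (i + j) * (suc j * V + i * V)                                     ≡⟨ collect i j V ⟩
  (i + j) * (suc (i + j) * V)                                       ∎)
  where
  open ≤-Reasoning
  bound : suc j * (i + j) * z + suc j * (x * j) + i * (x * suc j) ≤
          suc j * (i + j) * z + suc j * ((i + j) * a) + i * ((i + j) * b)
  bound = +-mono-≤ (+-monoʳ-≤ (suc j * (i + j) * z) (*-monoʳ-≤ (suc j) xj≤)) (*-monoʳ-≤ i xj+x≤)
  bound′ : (i + j) * (suc j * (z + a) + i * b) ≤ (i + j) * (suc j * V + i * V)
  bound′ = *-monoʳ-≤ (i + j) (+-mono-≤ (*-monoʳ-≤ (suc j) z+a≤V) (*-monoʳ-≤ i b≤V))
  expand : ∀ i j z x → (i + j) * ((z + x) * suc j) ≡
                       suc j * (i + j) * z + suc j * (x * j) + i * (x * suc j)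
  expand = solve-∀
  factor : ∀ i j z a b → suc j * (i + j) * z + suc j * ((i + j) * a) + i * ((i + j) * b) ≡
                         (i + j) * (suc j * (z + a) + i * b)
  factor = solve-∀
  collect : ∀ i j V → (i + j) * (suc j * V + i * V) ≡ (i + j) * (suc (i + j) * V)
  collect = solve-∀

averaged : ∀ {n} i j (X : List (Fin (suc n))) {a b V} → suc n ≡ suc i + suc j →
           length (preds X) * j ≤ n * a → length (preds X) * suc j ≤ n * b →
           zeros X + a ≤ V → b ≤ V → length X * suc j ≤ suc n * V
averaged {n} i j X {V = V} eq a≥ b≥ a≤ b≤ =
  subst (λ L → L * suc j ≤ suc n * V) (sym (length-zeros-preds X))
    (average (suc i) j (zeros X) (length (preds X)) {{≢-nonZero n≢0}} n≡ a≥ b≥ a≤ b≤)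
  where
  n≡ = trans (suc-injective eq) (+-suc i j)
  n≢0 : n ≢ 0
  n≢0 n≡0 with () ← trans (sym n≡0) n≡

-- The random choice made deterministic: `j` elements are to be taken and `i` left out. At each
-- element both choices are solved recursively, and the one with more hits is kept. Nothing to take
-- gives `⊥`, nothing to leave out gives `⊤`.
heavy-subset : ∀ {n} i j → n ≡ i + j → (X : List (Fin n)) →
               ∃[ T ] (∣ T ∣ ≤ j × length X * j ≤ n * hits T X)
heavy-subset {n} i zero _ X =
  ⊥ , ≤-reflexive (∣⊥∣≡0 n) , ≤-trans (≤-reflexive (*-zeroʳ (length X))) z≤n
heavy-subset zero (suc j) refl X = ⊤ , ≤-reflexive (∣⊤∣≡n (suc j)) , ≤-reflexive (begin
  length X * suc j          ≡⟨ *-comm (length X) (suc j) ⟩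
  suc j * length X          ≡⟨ cong (λ L → suc j * length L) (filter-all (_∈? ⊤) (All.universal (λ _ → ∈⊤) X)) ⟨
  suc j * hits ⊤ X          ∎)
  where open ≡-Reasoning
heavy-subset {suc n} (suc i) (suc j) eq X
  with T , ∣T∣≤j , T-hits ← heavy-subset (suc i) j (trans (suc-injective eq) (+-suc i j)) (preds X)
  with U , ∣U∣≤1+j , U-hits ← heavy-subset i (suc j) (suc-injective eq) (preds X)
  with ≤-total (zeros X + hits T (preds X)) (hits U (preds X))
... | inj₁ U-better = outside ∷ U , ∣U∣≤1+j ,
  averaged i j X eq T-hits U-hits (≤-trans U-better (hits-outside U X)) (hits-outside U X)
... | inj₂ T-better = inside ∷ T , s≤s ∣T∣≤j ,
  averaged i j X eq T-hits U-hits (hits-inside T X) (≤-trans T-better (hits-inside T X))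

-- Lowering the size of hyperedges by passing to links.

∈⇒≡⊎∈- : (p : Subset n) (x : Fin n) {y : Fin n} → y ∈ p → y ≡ x ⊎ y ∈ p - x
∈⇒≡⊎∈- p x {y} y∈p with y ≟ᶠ x
... | yes y≡x = inj₁ y≡x
... | no  y≢x = inj₂ (x∈p∧x≢y⇒x∈p-y y∈p y≢x)

drop-vertex : ∀ {t} (e : Subset s) {x T} → x ∈ e → x ∈ T → ∣ e ∣ ≤ 2 + t →
              ∃[ f ] ((1 ≤ ∣ f ∣ × ∣ f ∣ ≤ 1 + t) × (∀ {S} → f ⊆ S → e ⊆ S ∪ T))
drop-vertex e {x} {T} x∈e x∈T ∣e∣≤ with nonempty? (e - x)
... | yes (y , y∈e-x) =
  e - x , (x∈p⇒1≤∣p∣ y∈e-x , s≤s⁻¹ (≤-trans (x∈p⇒∣p-x∣<∣p∣ x∈e) ∣e∣≤)) , covers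
  where
  covers : ∀ {S} → e - x ⊆ S → e ⊆ S ∪ T
  covers {S} e-x⊆S z∈e with ∈⇒≡⊎∈- e x z∈e
  ... | inj₁ refl  = q⊆p∪q S T x∈T
  ... | inj₂ z∈e-x = p⊆p∪q T (e-x⊆S z∈e-x)
-- Here `e` is the singleton of `x`. Hyperedges must stay nonempty, so it is kept whole; its size 1
-- is within the lowered bound.
... | no empty =
  ⁅ x ⁆ , (≤-reflexive (sym (∣⁅x⁆∣≡1 x)) , ≤-trans (≤-reflexive (∣⁅x⁆∣≡1 x)) (s≤s z≤n)) , covers
  where
  covers : ∀ {S} → ⁅ x ⁆ ⊆ S → e ⊆ S ∪ T
  covers {S} _ z∈e with ∈⇒≡⊎∈- e x z∈e
  ... | inj₁ refl  = q⊆p∪q S T x∈T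
  ... | inj₂ z∈e-x = contradiction (_ , z∈e-x) empty

representatives : ∀ t (H : Hypergraph s) → IsTHypergraph t H → List (Fin s)
representatives t []      []             = []
representatives t (e ∷ H) ((1≤e , _) ∷ h) = proj₁ (1≤∣p∣⇒Nonempty {p = e} 1≤e) ∷ representatives t H h

length-representatives : ∀ t (H : Hypergraph s) (h : IsTHypergraph t H) →
                         length (representatives t H h) ≡ length H
length-representatives t []      []      = refl
length-representatives t (e ∷ H) (_ ∷ h) = cong suc (length-representatives t H h)

-- A hyperedge survives exactly when its chosen representative lies in `T`, and that vertex is then
-- dropped. Counting representatives turns the averaging bound for lists of vertices into one for
-- hyperedges.
link : ∀ t T (H : Hypergraph s) (h : IsTHypergraph (2 + t) H) →
       ∃[ H′ ] (IsTHypergraph (1 + t) H′ × length H′ ≡ hits T (representatives (2 + t) H h) ×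
                (∀ S → eH H′ S ≤ eH H (S ∪ T)))
link t T []      []                = [] , [] , refl , λ S → z≤n
link t T (e ∷ H) ((1≤e , e≤) ∷ h)
  with H′ , h′ , len , spans ← link t T H h
  with x , x∈e ← 1≤∣p∣⇒Nonempty {p = e} 1≤e
  with x ∈? T
... | no _ = H′ , h′ , len , λ S → count-skip (_⊆? S) (_⊆? (S ∪ T)) H′ e H (spans S)
... | yes x∈T with f , f-size , covers ← drop-vertex e x∈e x∈T e≤ =
  f ∷ H′ , f-size ∷ h′ , cong suc len , λ S → count-∷ (_⊆? S) (_⊆? (S ∪ T)) f H′ e H (λ f⊆S {_} → covers f⊆S) (spans S)

-- Each of the `n` rounds keeps at least a fraction ℓ/s of the hyperedges and adds at most ℓ
-- vertices to the set that restores the dropped ones.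
iterated-link : ∀ n {s ℓ} → ℓ ≤ s → (H : Hypergraph s) → IsTHypergraph (2 + n) H →
                ∃[ T ] ∃[ H′ ] (∣ T ∣ ≤ n * ℓ × IsTHypergraph 2 H′ ×
                                length H * ℓ ^ n ≤ s ^ n * length H′ × (∀ S → eH H′ S ≤ eH H (S ∪ T)))
iterated-link zero {s} ℓ≤s H h =
  ⊥ , H , ≤-reflexive (∣⊥∣≡0 s) , h , ≤-reflexive (*-comm (length H) 1) ,
  λ S → ≤-reflexive (cong (eH H) (sym (∪-identityʳ S)))
iterated-link (suc n) {s} {ℓ} ℓ≤s H h
  with T , ∣T∣≤ℓ , T-hits ← heavy-subset (s ∸ ℓ) ℓ (sym (m∸n+n≡m ℓ≤s)) (representatives (3 + n) H h)
  with H₁ , h₁ , len , spans ← link (suc n) T H h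
  with U , H₂ , ∣U∣≤nℓ , h₂ , dense , spans₂ ← iterated-link n ℓ≤s H₁ h₁
  = U ∪ T , H₂
  , ≤-trans (∣p∪q∣≤∣p∣+∣q∣ U T) (≤-trans (+-mono-≤ ∣U∣≤nℓ ∣T∣≤ℓ) (≤-reflexive (+-comm (n * ℓ) ℓ)))
  , h₂
  , (begin
      length H * (ℓ * ℓ ^ n)                                 ≡⟨ *-assoc (length H) ℓ (ℓ ^ n) ⟨
      length H * ℓ * ℓ ^ n                                   ≡⟨ cong (λ j → j * ℓ * ℓ ^ n) (length-representatives (3 + n) H h) ⟨
      length (representatives (3 + n) H h) * ℓ * ℓ ^ n       ≤⟨ *-monoˡ-≤ (ℓ ^ n) T-hits ⟩
      s * hits T (representatives (3 + n) H h) * ℓ ^ n       ≡⟨ cong (λ j → s * j * ℓ ^ n) len ⟨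
      s * length H₁ * ℓ ^ n                                  ≡⟨ *-assoc s (length H₁) (ℓ ^ n) ⟩
      s * (length H₁ * ℓ ^ n)                                ≤⟨ *-monoʳ-≤ s dense ⟩
      s * (s ^ n * length H₂)                                ≡⟨ *-assoc s (s ^ n) (length H₂) ⟨
      s * s ^ n * length H₂                                  ∎)
  , λ S → ≤-trans (spans₂ S) (≤-trans (spans (S ∪ U)) (≤-reflexive (cong (eH H) (∪-assoc S U T))))
  where open ≤-Reasoning

-- Passing to a multigraph and packing sets of positive excess.

endpoints : (e : Subset s) → 1 ≤ ∣ e ∣ → ∣ e ∣ ≤ 2 → ∃[ f ] (∀ {S} → Spans S f → e ⊆ S)
endpoints e 1≤e e≤2 with u , u∈e ← 1≤∣p∣⇒Nonempty {p = e} 1≤e with nonempty? (e - u)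
-- A hyperedge with a single vertex becomes a loop.
... | no empty = (u , u) , covers
  where
  covers : ∀ {S} → Spans S (u , u) → e ⊆ S
  covers (u∈S , _) z∈e with ∈⇒≡⊎∈- e u z∈e
  ... | inj₁ refl  = u∈S
  ... | inj₂ z∈e-u = contradiction (_ , z∈e-u) empty
... | yes (v , v∈e-u) = (u , v) , covers
  where
  covers : ∀ {S} → Spans S (u , v) → e ⊆ S
  covers (u∈S , v∈S) z∈e with ∈⇒≡⊎∈- e u z∈e
  ... | inj₁ refl  = u∈S
  ... | inj₂ z∈e-u with ∈⇒≡⊎∈- (e - u) v z∈e-u
  ...   | inj₁ refl    = v∈S
  ...   | inj₂ z∈e-u-v = contradiction e≤2 (<⇒≱ (≤-trans
          (s≤s (≤-trans (s≤s (x∈p⇒1≤∣p∣ z∈e-u-v)) (x∈p⇒∣p-x∣<∣p∣ v∈e-u))) (x∈p⇒∣p-x∣<∣p∣ u∈e)))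

toMultigraph : (H : Hypergraph s) → IsTHypergraph 2 H →
               ∃[ E ] (length E ≡ length H × (∀ S → eG E S ≤ eH H S))
toMultigraph []      []                 = [] , refl , λ S → z≤n
toMultigraph (e ∷ H) ((1≤e , e≤2) ∷ h)
  with E , len , spans ← toMultigraph H h
  with f , covers ← endpoints e 1≤e e≤2
  = f ∷ E , cong suc len , λ S → count-∷ (spansEdge S) (_⊆? S) f E e H (λ f∈S {_} → covers f∈S) (spans S)

unspanned : Multigraph s → Subset s → Multigraph s
unspanned E S = filter (¬? ∘ spansEdge S) E

length-unspanned : (E : Multigraph s) (S : Subset s) → eG E S + length (unspanned E S) ≡ length E
length-unspanned E S = count-complement (spansEdge S) E

-- Restricting `T` to the edges not spanned by `S` prevents double counting, so excesses add even if
-- the two sets overlap.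
eG-∪ : (E : Multigraph s) (S T : Subset s) → eG E S + eG (unspanned E S) T ≤ eG E (S ∪ T)
eG-∪ E S T = count-disjoint (spansEdge S) (spansEdge T) (spansEdge (S ∪ T))
  (λ {e} → Spans-mono {e = e} (p⊆p∪q T)) (λ {e} → Spans-mono {e = e} (q⊆p∪q S T)) E

^-cancelˡ-≤ : ∀ b {m n} → 1 < b → b ^ m ≤ b ^ n → m ≤ n
^-cancelˡ-≤ b {m} {n} 1<b b^m≤b^n with m ≤? n
... | yes m≤n = m≤n
... | no  m≰n = contradiction b^m≤b^n (<⇒≱ (^-monoʳ-< b 1<b (≰⇒> m≰n)))

-- Each step applies `moore` with `N = 1` to the unspanned edges: at most 7 log₂ s new vertices for
-- one more unit of excess. `room` says 8r log₂ s ≤ s.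
pack : ∀ {s} → 2 ≤ s → ∀ r (E : Multigraph s) → 3 * s ≤ length E → s ^ (8 * r) ≤ 2 ^ s →
       ∃[ S ] (2 ^ ∣ S ∣ ≤ s ^ (7 * r) × ∣ S ∣ + r ≤ eG E S)
pack {s} 2≤s zero    E 3s≤E room =
  ⊥ , ≤-reflexive (cong (2 ^_) (∣⊥∣≡0 s)) , ≤-trans (≤-reflexive (trans (+-identityʳ _) (∣⊥∣≡0 s))) z≤n
pack {s} 2≤s (suc r) E 3s≤E room = extend (pack 2≤s r E 3s≤E (≤-trans (^-monoʳ-≤ s (*-monoʳ-≤ 8 (n≤1+n r))) room))
  where
  open ≤-Reasoning
  instance
    s≢0 : NonZero s
    s≢0 = >-nonZero (<-≤-trans z<s 2≤s)
  extend : ∃[ S ] (2 ^ ∣ S ∣ ≤ s ^ (7 * r) × ∣ S ∣ + r ≤ eG E S) →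
           ∃[ S ] (2 ^ ∣ S ∣ ≤ s ^ (7 * suc r) × ∣ S ∣ + suc r ≤ eG E S)
  extend (S , size , excess) with ∣ S ∣ + suc r ≤? eG E S
  ... | yes enough = S , ≤-trans size (^-monoʳ-≤ s (*-monoʳ-≤ 7 (n≤1+n r))) , enough
  ... | no ¬enough = join-with (moore 2≤s 1 (unspanned E S) dense)
    where
    -- The 7r log₂ s vertices and the `r` units of excess fit together into 8r log₂ s. As `¬enough`
    -- bounds the spanned edges by `∣ S ∣ + r`, at least 2s of the 3s edges stay unspanned.
    ∣S∣+r≤s : ∣ S ∣ + r ≤ s
    ∣S∣+r≤s = ^-cancelˡ-≤ 2 ≤-refl (begin
      2 ^ (∣ S ∣ + r)           ≡⟨ ^-distribˡ-+-* 2 (∣ S ∣) r ⟩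
      2 ^ ∣ S ∣ * 2 ^ r         ≤⟨ *-mono-≤ size (^-monoˡ-≤ r 2≤s) ⟩
      s ^ (7 * r) * s ^ r       ≡⟨ ^-distribˡ-+-* s (7 * r) r ⟨
      s ^ (7 * r + r)           ≡⟨ cong (s ^_) (+-comm (7 * r) r) ⟩
      s ^ (8 * r)               ≤⟨ ^-monoʳ-≤ s (*-monoʳ-≤ 8 (n≤1+n r)) ⟩
      s ^ (8 * suc r)           ≤⟨ room ⟩
      2 ^ s                     ∎)
    spanned≤s : eG E S ≤ s
    spanned≤s = ≤-trans (s≤s⁻¹ (≤-trans (≰⇒> ¬enough) (≤-reflexive (+-suc ∣ S ∣ r)))) ∣S∣+r≤s
    dense : 2 * s ≤ 1 * length (unspanned E S)
    dense = +-cancelˡ-≤ s _ _ (begin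
      s + 2 * s                             ≤⟨ 3s≤E ⟩
      length E                              ≡⟨ length-unspanned E S ⟨
      eG E S + length (unspanned E S)       ≤⟨ +-monoˡ-≤ _ spanned≤s ⟩
      s + length (unspanned E S)            ≡⟨ cong (s +_) (*-identityˡ _) ⟨
      s + 1 * length (unspanned E S)        ∎)
    join-with : ∃[ T ] (2 ^ ∣ T ∣ ≤ s ^ 7 × suc ∣ T ∣ ≤ eG (unspanned E S) T) →
                ∃[ U ] (2 ^ ∣ U ∣ ≤ s ^ (7 * suc r) × ∣ U ∣ + suc r ≤ eG E U)
    join-with (T , T-size , T-excess) = S ∪ T ,
      (begin
        2 ^ ∣ S ∪ T ∣             ≤⟨ ^-monoʳ-≤ 2 (∣p∪q∣≤∣p∣+∣q∣ S T) ⟩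
        2 ^ (∣ S ∣ + ∣ T ∣)       ≡⟨ ^-distribˡ-+-* 2 (∣ S ∣) (∣ T ∣) ⟩
        2 ^ ∣ S ∣ * 2 ^ ∣ T ∣     ≤⟨ *-mono-≤ size T-size ⟩
        s ^ (7 * r) * s ^ 7       ≡⟨ ^-distribˡ-+-* s (7 * r) 7 ⟨
        s ^ (7 * r + 7)           ≡⟨ cong (s ^_) (trans (+-comm (7 * r) 7) (sym (*-suc 7 r))) ⟩
        s ^ (7 * suc r)           ∎) ,
      (begin
        ∣ S ∪ T ∣ + suc r                     ≤⟨ +-monoˡ-≤ (suc r) (∣p∪q∣≤∣p∣+∣q∣ S T) ⟩
        ∣ S ∣ + ∣ T ∣ + suc r                 ≡⟨ regroup (∣ S ∣) (∣ T ∣) r ⟩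
        ∣ S ∣ + r + suc ∣ T ∣                 ≤⟨ +-mono-≤ excess T-excess ⟩
        eG E S + eG (unspanned E S) T         ≤⟨ eG-∪ E S T ⟩
        eG E (S ∪ T)                          ∎)
      where
      regroup : ∀ a b r → a + b + suc r ≡ a + r + suc b
      regroup = solve-∀

-- Part (2): choice of parameters and assembly.

last-true : ∀ {P : ℕ → Set} → (∀ n → Dec (P n)) → P 0 → ∀ fuel → ¬ P fuel → ∃[ n ] (P n × ¬ P (suc n))
last-true P? P0 zero       ¬P = contradiction P0 ¬P
last-true P? P0 (suc fuel) ¬P with P? fuel
... | yes P = fuel , P , ¬P
... | no ¬P = last-true P? P0 fuel ¬P

n<2^n : ∀ n → n < 2 ^ n
n<2^n zero    = z<s
n<2^n (suc n) = begin-strict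
  suc n               ≤⟨ n<2^n n ⟩
  2 ^ n               <⟨ m<m+n (2 ^ n) (m^n>0 2 n) ⟩
  2 ^ n + 2 ^ n       ≡⟨ cong (2 ^ n +_) (+-identityʳ (2 ^ n)) ⟨
  2 ^ suc n           ∎
  where open ≤-Reasoning

-- Here t = 2 + n and y = 2 + ℓ₀ is ⌊k / (2^(t+1) log₂ s)⌋; the density hypothesis is needed only
-- for the single approximation log₂ s ≥ k / (2^(t+3) ℓ).
hypergraph-part : ∀ n → 1 ≤ n → ∀ s → 2 ≤ s → (H : Hypergraph s) → IsTHypergraph (2 + n) H →
                  ∀ k → k ≤ s → s ^ (2 ^ (2 + n + 2)) ≤ 2 ^ k →
                  (∀ a b → 0 < b → a / b ≤log₂ s →
                    3 * s * (2 ^ (2 + n + 3) * s * a) ^ n ≤ length H * (k * b) ^ n) →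
                  ∃[ S ] (∣ S ∣ ≤ k × ∣ S ∣ ≤ eH H S ×
                          2 ^ k ≤ s ^ ((eH H S ∸ ∣ S ∣) * 2 ^ (2 + n + 1)))
hypergraph-part n 1≤n s 2≤s H h k k≤s large hyp =
  -- The floor is sought among the numbers 2 + i. The hypothesis k ≥ 2^(t+2) log₂ s makes 2 fit, so
  -- that ℓ is positive, and 2 + k is too large because c(2 + k) exceeds k.
  conclude (last-true (λ i → s ^ (c * (2 + i)) ≤? 2 ^ k) 2-fits k k+2-too-big)
  where
  open ≤-Reasoning
  c = 2 ^ (2 + n + 1)
  instance
    s≢0 : NonZero s
    s≢0 = >-nonZero (<-≤-trans z<s 2≤s)
    c≢0 : NonZero c
    c≢0 = m^n≢0 2 (2 + n + 1)

  s^m≤2^k⇒m≤k : ∀ {m} → s ^ m ≤ 2 ^ k → m ≤ k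
  s^m≤2^k⇒m≤k {m} s^m≤2^k = ^-cancelˡ-≤ 2 ≤-refl (≤-trans (^-monoˡ-≤ m 2≤s) s^m≤2^k)

  2-fits : s ^ (c * 2) ≤ 2 ^ k
  2-fits = subst (λ j → s ^ j ≤ 2 ^ k) (trans (cong (2 ^_) (+-suc (2 + n) 1)) (*-comm 2 c)) large

  k+2-too-big : ¬ s ^ (c * (2 + k)) ≤ 2 ^ k
  k+2-too-big fits = <⇒≱ (m<n+m k z<s) (≤-trans (m≤n*m (2 + k) c) (s^m≤2^k⇒m≤k fits))

  conclude : ∃[ i ] (s ^ (c * (2 + i)) ≤ 2 ^ k × ¬ s ^ (c * (3 + i)) ≤ 2 ^ k) →
             ∃[ S ] (∣ S ∣ ≤ k × ∣ S ∣ ≤ eH H S × 2 ^ k ≤ s ^ ((eH H S ∸ ∣ S ∣) * c))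
  conclude (ℓ₀ , fits , ¬fits) = assemble (iterated-link n ℓ≤s H h)
    where
    ℓ = suc ℓ₀
    y = suc ℓ
    -- The excess `y + 1` is wanted in the end; `n * ℓ` pays for the vertices dropped in the links.
    r = suc y + n * ℓ

    cy≤k : c * y ≤ k
    cy≤k = s^m≤2^k⇒m≤k fits
    y≤k : y ≤ k
    y≤k = ≤-trans (m≤n*m y c) cy≤k
    ℓ≤s : ℓ ≤ s
    ℓ≤s = ≤-trans (n≤1+n ℓ) (≤-trans y≤k k≤s)
    instance
      k≢0 : NonZero k
      k≢0 = >-nonZero (<-≤-trans z<s y≤k)

    -- This fixes the constant: c = 2^(t+1) is 8 times 2^n, and r ≤ (n + 1)y ≤ 2^n y, where n ≥ 1
    -- absorbs the extra unit in `r`.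
    8r≤cy : 8 * r ≤ c * y
    8r≤cy = begin
      8 * r                       ≤⟨ *-monoʳ-≤ 8 r≤ ⟩
      8 * (2 ^ n * y)             ≡⟨ *-assoc 8 (2 ^ n) y ⟨
      8 * 2 ^ n * y               ≡⟨ cong (_* y) (^-distribˡ-+-* 2 3 n) ⟨
      2 ^ (3 + n) * y             ≡⟨ cong (λ j → 2 ^ j * y) (+-comm 1 (2 + n)) ⟩
      c * y                       ∎
      where
      r≤ : r ≤ 2 ^ n * y
      r≤ = begin
        suc y + n * ℓ             ≡⟨ regroup ℓ n ⟩
        1 + (ℓ + n * ℓ) + 1       ≤⟨ +-monoʳ-≤ (1 + (ℓ + n * ℓ)) 1≤n ⟩
        1 + (ℓ + n * ℓ) + n       ≡⟨ collect ℓ n ⟩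
        suc n * y                 ≤⟨ *-monoˡ-≤ y (n<2^n n) ⟩
        2 ^ n * y                 ∎
        where
        regroup : ∀ ℓ n → 2 + ℓ + n * ℓ ≡ 1 + (ℓ + n * ℓ) + 1
        regroup = solve-∀
        collect : ∀ ℓ n → 1 + (ℓ + n * ℓ) + n ≡ suc n * suc ℓ
        collect = solve-∀

    -- Taking a = k and b = Bℓ replaces log₂ s by its lower bound k/(Bℓ). The base B s log₂ s / k of
    -- the hypothesis then becomes s/ℓ.
    dense : 3 * s * s ^ n ≤ length H * ℓ ^ n
    dense = *-cancelʳ-≤ _ _ ((B * k) ^ n) {{m^n≢0 (B * k) n {{m*n≢0 B k {{m^n≢0 2 (2 + n + 3)}}}}}} (begin
      3 * s * s ^ n * (B * k) ^ n           ≡⟨ *-assoc (3 * s) (s ^ n) _ ⟩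
      3 * s * (s ^ n * (B * k) ^ n)         ≡⟨ cong (3 * s *_) (^-distribʳ-* s (B * k) n) ⟨
      3 * s * (s * (B * k)) ^ n             ≡⟨ cong (λ j → 3 * s * j ^ n) (left s B k) ⟩
      3 * s * (B * s * k) ^ n               ≤⟨ hyp k (B * ℓ) (*-mono-≤ (m^n>0 2 (2 + n + 3)) (s≤s z≤n)) k/Bℓ≤log₂s ⟩
      length H * (k * (B * ℓ)) ^ n          ≡⟨ cong (λ j → length H * j ^ n) (right k B ℓ) ⟩
      length H * (ℓ * (B * k)) ^ n          ≡⟨ cong (length H *_) (^-distribʳ-* ℓ (B * k) n) ⟩
      length H * (ℓ ^ n * (B * k) ^ n)      ≡⟨ *-assoc (length H) (ℓ ^ n) _ ⟨
      length H * ℓ ^ n * (B * k) ^ n        ∎)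
      where
      B = 2 ^ (2 + n + 3)
      left : ∀ s B k → s * (B * k) ≡ B * s * k
      left = solve-∀
      right : ∀ k B ℓ → k * (B * ℓ) ≡ ℓ * (B * k)
      right = solve-∀
      -- `¬fits` gives k ≤ c(y + 1) log₂ s, and y + 1 = 3 + ℓ₀ is at most 4ℓ; this factor 4 takes
      -- 2^(t+1) to 2^(t+3).
      k/Bℓ≤log₂s : 2 ^ k ≤ s ^ (B * ℓ)
      k/Bℓ≤log₂s = ≤-trans (≰⇒≥ ¬fits) (^-monoʳ-≤ s (begin
        c * suc y         ≤⟨ *-monoʳ-≤ c (m≤m+n (3 + ℓ₀) (1 + 3 * ℓ₀)) ⟩
        c * (3 + ℓ₀ + (1 + 3 * ℓ₀))   ≡⟨ quadruple c ℓ₀ ⟩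
        4 * c * ℓ         ≡⟨ cong (_* ℓ) (^-distribˡ-+-* 2 2 (2 + n + 1)) ⟨
        2 ^ (2 + (2 + n + 1)) * ℓ   ≡⟨ cong (λ j → 2 ^ j * ℓ) (shift-exponent n) ⟩
        B * ℓ             ∎))
        where
        quadruple : ∀ c i → c * (3 + i + (1 + 3 * i)) ≡ 4 * c * suc i
        quadruple = solve-∀
        shift-exponent : ∀ n → 2 + (2 + n + 1) ≡ 2 + n + 3
        shift-exponent = solve-∀

    assemble : ∃[ T ] ∃[ H′ ] (∣ T ∣ ≤ n * ℓ × IsTHypergraph 2 H′ ×
                 length H * ℓ ^ n ≤ s ^ n * length H′ × (∀ S → eH H′ S ≤ eH H (S ∪ T))) →
               ∃[ S ] (∣ S ∣ ≤ k × ∣ S ∣ ≤ eH H S × 2 ^ k ≤ s ^ ((eH H S ∸ ∣ S ∣) * c))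
    assemble (T , H′ , ∣T∣≤ , h′ , denseH′ , spans)
      with E , len , E-spans ← toMultigraph H′ h′ = add-T (pack 2≤s r E 3s≤E room)
      where
      3s≤E : 3 * s ≤ length E
      3s≤E = *-cancelˡ-≤ (s ^ n) {{m^n≢0 s n}} (begin
        s ^ n * (3 * s)       ≡⟨ *-comm (s ^ n) (3 * s) ⟩
        3 * s * s ^ n         ≤⟨ dense ⟩
        length H * ℓ ^ n      ≤⟨ denseH′ ⟩
        s ^ n * length H′     ≡⟨ cong (s ^ n *_) len ⟨
        s ^ n * length E      ∎)
      room : s ^ (8 * r) ≤ 2 ^ s
      room = ≤-trans (^-monoʳ-≤ s 8r≤cy) (≤-trans fits (^-monoʳ-≤ 2 k≤s))

      add-T : ∃[ S ] (2 ^ ∣ S ∣ ≤ s ^ (7 * r) × ∣ S ∣ + r ≤ eG E S) →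
              ∃[ S ] (∣ S ∣ ≤ k × ∣ S ∣ ≤ eH H S × 2 ^ k ≤ s ^ ((eH H S ∸ ∣ S ∣) * c))
      add-T (S , size , excess) =
        -- By `¬fits`, k is at most c(y + 1) log₂ s, so an excess of `y + 1` suffices.
        S ∪ T , bound , ≤-trans (m≤n+m _ (suc y)) excess′ , ≤-trans (≰⇒≥ ¬fits) (^-monoʳ-≤ s (begin
          c * suc y                                   ≡⟨ *-comm c (suc y) ⟩
          suc y * c                                   ≡⟨ cong (_* c) (m+n∸n≡m (suc y) (∣ S ∪ T ∣)) ⟨
          (suc y + ∣ S ∪ T ∣ ∸ ∣ S ∪ T ∣) * c         ≤⟨ *-monoˡ-≤ c (∸-monoˡ-≤ ∣ S ∪ T ∣ excess′) ⟩
          (eH H (S ∪ T) ∸ ∣ S ∪ T ∣) * c              ∎))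
        where
        ∣S∪T∣≤ : ∣ S ∪ T ∣ ≤ ∣ S ∣ + n * ℓ
        ∣S∪T∣≤ = ≤-trans (∣p∪q∣≤∣p∣+∣q∣ S T) (+-monoʳ-≤ ∣ S ∣ ∣T∣≤)
        excess′ : suc y + ∣ S ∪ T ∣ ≤ eH H (S ∪ T)
        excess′ = begin
          suc y + ∣ S ∪ T ∣             ≤⟨ +-monoʳ-≤ (suc y) ∣S∪T∣≤ ⟩
          suc y + (∣ S ∣ + n * ℓ)       ≡⟨ swap (suc y) (∣ S ∣) (n * ℓ) ⟩
          ∣ S ∣ + r                     ≤⟨ excess ⟩
          eG E S                        ≤⟨ E-spans S ⟩
          eH H′ S                       ≤⟨ spans S ⟩
          eH H (S ∪ T)                  ∎
          where
          swap : ∀ a b c → a + (b + c) ≡ b + (a + c)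
          swap = solve-∀
        -- `S` takes 7r log₂ s; since n ℓ ≤ r, the eighth r log₂ s covers `T`.
        bound : ∣ S ∪ T ∣ ≤ k
        bound = ^-cancelˡ-≤ 2 ≤-refl (begin
          2 ^ ∣ S ∪ T ∣                 ≤⟨ ^-monoʳ-≤ 2 ∣S∪T∣≤ ⟩
          2 ^ (∣ S ∣ + n * ℓ)           ≡⟨ ^-distribˡ-+-* 2 (∣ S ∣) (n * ℓ) ⟩
          2 ^ ∣ S ∣ * 2 ^ (n * ℓ)       ≤⟨ *-mono-≤ size (^-monoˡ-≤ (n * ℓ) 2≤s) ⟩
          s ^ (7 * r) * s ^ (n * ℓ)     ≤⟨ *-monoʳ-≤ (s ^ (7 * r)) (^-monoʳ-≤ s (m≤n+m (n * ℓ) (suc y))) ⟩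
          s ^ (7 * r) * s ^ r           ≡⟨ ^-distribˡ-+-* s (7 * r) r ⟨
          s ^ (7 * r + r)               ≡⟨ cong (s ^_) (+-comm (7 * r) r) ⟩
          s ^ (8 * r)                   ≤⟨ ^-monoʳ-≤ s 8r≤cy ⟩
          s ^ (c * y)                   ≤⟨ fits ⟩
          2 ^ k                         ∎)

theorem2 : ((s : ℕ) → 2 ≤ s → (E : Multigraph s) → (p q : ℕ) → 0 < p → p ≤ q →
    q * length E ≥ s * (q + p) →
    ∃[ S ] (2 ^ ∣ S ∣ ≤ s ^ (8 * ⌈ q ÷ p ⌉) × suc ∣ S ∣ ≤ eG E S))
    ×
    ((t : ℕ) → 3 ≤ t → (s : ℕ) → 2 ≤ s → (H : Hypergraph s) → IsTHypergraph t H →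
    (k : ℕ) → k ≤ s → s ^ (2 ^ (t + 2)) ≤ 2 ^ k →
    ((a b : ℕ) → 0 < b → a / b ≤log₂ s →
    3 * s * (2 ^ (t + 3) * s * a) ^ (t ∸ 2) ≤ length H * (k * b) ^ (t ∸ 2)) →
    ∃[ S ] (∣ S ∣ ≤ k × ∣ S ∣ ≤ eH H S ×
    2 ^ k ≤ s ^ ((eH H S ∸ ∣ S ∣) * 2 ^ (t + 1))))
theorem2 = graph-part , λ { (suc (suc n)) (s≤s (s≤s 1≤n)) → hypergraph-part n 1≤n }
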